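{- Let $S$ be an acyclic laminary set on a finite alphabet $A$ relative to an involution $\theta$. Any finite symmetric bifix code $X\subset S$ is the set of prime words in $S$ with respect to the subgroup $\langle X\rangle$ of $G_\theta$ generated by $X$. Moreover $\langle X\rangle\cap S=X^*\cap S$.
   Context: Words are over a finite alphabet $A$; $\varepsilon$ is the empty word. A set $S$ of words on $A$ is factorial if it contains $A$ and all the factors of its elements. For $w\in S$ let $L(w)=\{a\in A\mid aw\in S\}$, $R(w)=\{a\in A\mid wa\in S\}$, $B(w)=\{(a,b)\in A\times A\mid awb\in S\}$. A factorial set $S$ is biextendable if $B(w)\neq\emptyset$ for all $w\in S$. The extension graph $\mathcal{E}(w)$ is the undirected graph whose vertex set is the disjoint union of $L(w)$ and $R(w)$ and whose edges are the pairs in $B(w)$. A biextendable set $S$ is acyclic if $\mathcal{E}(w)$ is acyclic for every $w\in S$ (including $w=\varepsilon$). Let $\theta$ be an involution on $A$ (possibly with fixed points) and let $G_\theta$ be the group generated by $A$ with relations $a\theta(a)=1$, $a\in A$ (so $a^{ -1}=\theta(a)$). A word is reduced if it has no factor $a\theta(a)$ with $a\in A$; every element of $G_\theta$ is represented by a unique reduced word, and reduced words are identified with elements of $G_\theta$. A laminary set on $A$ relative to $\theta$ is a biextendable set of reduced words closed under taking inverses. Symmetric means closed under taking inverses. A bifix code is a set of nonempty words in which no element is a proper prefix or a proper suffix of another. $X^*$ is the submonoid of the free monoid $A^*$ generated by $X$. For a subgroup $H$ of $G_\theta$, the set of prime words in $S$ with respect to $H$ is the set of nonempty words in $H\cap S$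 without a proper nonempty prefix in $H\cap S$. -}

module Defs where

open import Algebra.Bundles using (Group)
import Algebra.Properties.Group as GroupProperties
open import Data.List.Base using (List; []; _∷_; [_]; _++_; _∷ʳ_; length; map; reverse)
open import Data.List.Membership.Propositional using (_∈_)
open import Data.List.Properties using (unfold-reverse)
open import Data.List.Relation.Binary.Infix.Heterogeneous using (Infix)
open import Data.List.Relation.Binary.Prefix.Heterogeneous using (Prefix)
open import Data.List.Relation.Binary.Suffix.Heterogeneous using (Suffix)
open import Data.List.Relation.Unary.All using (All)
open import Data.List.Relation.Unary.Linked using (Linked)
open import Data.List.Relation.Unary.Unique.Propositional using (Unique)
open import Data.Nat.Base using (_≤_)
open import Data.Product.Base using (Σ; _×_; _,_; ∃; ∃₂)
open import Data.Sum.Base using (_⊎_; inj₁; inj₂)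
open import Function.Bundles using (_⇔_)
open import Level using (Level; _⊔_; suc)
open import Relation.Binary.Core using (Rel)
open import Relation.Binary.Definitions using (Symmetric)
open import Relation.Binary.PropositionalEquality.Core using (_≡_; _≢_)
open import Relation.Nullary.Negation.Core using (¬_)
open import Relation.Unary using (Pred; _⊆_; _∩_; _⊢_; _⟨⊎⟩_)

private
  variable
    a c ℓ p s x h e : Level

Finite : {B : Set a} → Pred B p → Set (a ⊔ p)
Finite {B = B} P = Σ (List B) λ xs → ∀ b → P b ⇔ b ∈ xs

-- Undirected simple graphs. The vertex set is a subset of a carrier type rather
-- than a type of its own: a Σ-type over a proof-relevant predicate would count a
-- vertex once for each proof of membership.
record Graph c p e : Set (suc (c ⊔ p ⊔ e)) where
  field
    Carrier : Set c
    Vertex  : Pred Carrier p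
    Adj     : Rel Carrier e
    adj-sym : Symmetric Adj

module _ (Γ : Graph c p e) where
  open Graph Γ

  -- The cycle v, v₁, …, vₖ, v is given by v and vs = v₁ ∷ … ∷ vₖ.
  record Cycle : Set (c ⊔ p ⊔ e) where
    field
      v        : Carrier
      vs       : List Carrier
      vertices : All Vertex (v ∷ vs)
      distinct : Unique (v ∷ vs)
      size     : 3 ≤ length (v ∷ vs)
      closed   : Linked Adj (v ∷ vs ∷ʳ v)

  AcyclicGraph : Set (c ⊔ p ⊔ e)
  AcyclicGraph = ¬ Cycle

module _ (G : Group c ℓ) where
  open Group G

  data GeneratedSubgroup (P : Pred Carrier p) : Pred Carrier (c ⊔ ℓ ⊔ p) where
    gen  : ∀ {g} → P g → GeneratedSubgroup P g
    unit : GeneratedSubgroup P ε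
    mul  : ∀ {g k} → GeneratedSubgroup P g → GeneratedSubgroup P k → GeneratedSubgroup P (g ∙ k)
    inv  : ∀ {g} → GeneratedSubgroup P g → GeneratedSubgroup P (g ⁻¹)
    resp : ∀ {g k} → g ≈ k → GeneratedSubgroup P g → GeneratedSubgroup P k

module Words (A : Set a) where

  Word : Set a
  Word = List A

  ProperPrefix ProperSuffix : Rel Word a
  ProperPrefix u w = Prefix _≡_ u w × u ≢ w
  ProperSuffix u w = Suffix _≡_ u w × u ≢ w

  record Factorial (S : Pred Word s) : Set (a ⊔ s) where
    field
      letters : ∀ b → S [ b ]
      factors : ∀ {u w} → Infix _≡_ u w → S w → S u

  L R : Pred Word s → Word → Pred A s
  L S w b = S (b ∷ w)
  R S w b = S (w ∷ʳ b)

  B : Pred Word s → Word → A → A → Set s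
  B S w b d = S (b ∷ w ∷ʳ d)

  record Biextendable (S : Pred Word s) : Set (a ⊔ s) where
    field
      factorial : Factorial S
      extend    : ∀ {w} → S w → ∃₂ λ b d → B S w b d

  data ExtensionAdj (S : Pred Word s) (w : Word) : Rel (A ⊎ A) (a ⊔ s) where
    leftRight : ∀ {b d} → B S w b d → ExtensionAdj S w (inj₁ b) (inj₂ d)
    rightLeft : ∀ {b d} → B S w b d → ExtensionAdj S w (inj₂ d) (inj₁ b)

  extensionGraph : Pred Word s → Word → Graph a s (a ⊔ s)
  extensionGraph S w = record
    { Carrier = A ⊎ A
    ; Vertex  = L S w ⟨⊎⟩ R S w
    ; Adj     = ExtensionAdj S w
    ; adj-sym = λ { (leftRight q) → rightLeft q ; (rightLeft q) → leftRight q }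
    }

  record Acyclic (S : Pred Word s) : Set (a ⊔ s) where
    field
      biextendable : Biextendable S
      acyclic      : ∀ {w} → S w → AcyclicGraph (extensionGraph S w)

  record BifixCode (X : Pred Word x) : Set (a ⊔ x) where
    field
      nonempty : ∀ {w} → X w → w ≢ []
      prefix   : ∀ {u w} → X u → X w → ¬ ProperPrefix u w
      suffix   : ∀ {u w} → X u → X w → ¬ ProperSuffix u w

  -- The submonoid of the free monoid generated by X.
  data _* (X : Pred Word x) : Pred Word (a ⊔ x) where
    gen  : ∀ {w} → X w → (X *) w
    unit : (X *) []
    mul  : ∀ {u w} → (X *) u → (X *) w → (X *) (u ++ w)

module Laminary {A : Set a} (θ : A → A) where
  open Words A

  data Term : Set a where
    letter : A → Term
    one    : Term
    _·_    : Term → Term → Term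
    _⁻     : Term → Term

  infixl 7 _·_
  infix  8 _⁻
  infix  4 _~_

  -- The congruence generated by the group axioms and the relations a θ(a) = 1.
  data _~_ : Rel Term a where
    relation  : ∀ b → letter b · letter (θ b) ~ one
    assoc     : ∀ t u v → (t · u) · v ~ t · (u · v)
    identityˡ : ∀ t → one · t ~ t
    identityʳ : ∀ t → t · one ~ t
    inverseˡ  : ∀ t → t ⁻ · t ~ one
    inverseʳ  : ∀ t → t · t ⁻ ~ one
    ·-cong    : ∀ {t t′ u u′} → t ~ t′ → u ~ u′ → t · u ~ t′ · u′
    ⁻-cong    : ∀ {t t′} → t ~ t′ → t ⁻ ~ t′ ⁻
    ~-refl    : ∀ {t} → t ~ t
    ~-sym     : ∀ {t u} → t ~ u → u ~ t
    ~-trans   : ∀ {t u v} → t ~ u → u ~ v → t ~ v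

  Gθ : Group a a
  Gθ = record
    { Carrier = Term
    ; _≈_     = _~_
    ; _∙_     = _·_
    ; ε       = one
    ; _⁻¹     = _⁻
    ; isGroup = record
      { isMonoid = record
        { isSemigroup = record
          { isMagma = record
            { isEquivalence = record { refl = ~-refl ; sym = ~-sym ; trans = ~-trans }
            ; ∙-cong        = ·-cong
            }
          ; assoc = assoc
          }
        ; identity = identityˡ , identityʳ
        }
      ; inverse = inverseˡ , inverseʳ
      ; ⁻¹-cong = ⁻-cong
      }
    }

  -- The element of Gθ represented by a word.
  ⟦_⟧ : Word → Term
  ⟦ [] ⟧    = one
  ⟦ b ∷ w ⟧ = letter b · ⟦ w ⟧

  Reduced : Pred Word a
  Reduced w = ∀ b → ¬ Infix _≡_ (b ∷ θ b ∷ []) w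

  -- Reduced if w is (for θ involutive); ⟦⟧-inverse shows that it
  -- represents the inverse of w in Gθ.
  inverse : Word → Word
  inverse w = reverse (map θ w)

  private
    ⟦⟧-∷ʳ : ∀ w b → ⟦ w ∷ʳ b ⟧ ~ ⟦ w ⟧ · letter b
    ⟦⟧-∷ʳ []      b = ~-trans (identityʳ _) (~-sym (identityˡ _))
    ⟦⟧-∷ʳ (d ∷ w) b = ~-trans (·-cong ~-refl (⟦⟧-∷ʳ w b)) (~-sym (assoc _ _ _))

  ⟦⟧-inverse : ∀ w → ⟦ inverse w ⟧ ~ ⟦ w ⟧ ⁻
  ⟦⟧-inverse []      = ~-sym (GroupProperties.ε⁻¹≈ε Gθ)
  ⟦⟧-inverse (b ∷ w) rewrite unfold-reverse (θ b) (map θ w) =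
    ~-trans (⟦⟧-∷ʳ (inverse w) (θ b))
    (~-trans (·-cong (⟦⟧-inverse w) (GroupProperties.inverseʳ-unique Gθ _ _ (relation b)))
    (~-sym (GroupProperties.⁻¹-anti-homo-∙ Gθ _ _)))

  ClosedUnderInverse : Pred Word s → Set (a ⊔ s)
  ClosedUnderInverse S = ∀ {w} → S w → S (inverse w)

  record LaminarySet (S : Pred Word s) : Set (a ⊔ s) where
    field
      biextendable : Biextendable S
      reduced      : S ⊆ Reduced
      symmetric    : ClosedUnderInverse S

  -- The subgroup of Gθ generated by the elements that words of X represent.
  ⟨_⟩ : Pred Word x → Pred Term (a ⊔ x)
  ⟨ X ⟩ = GeneratedSubgroup Gθ λ g → ∃ λ w → X w × g ~ ⟦ w ⟧

  -- H ∩ S, where a reduced word is identified with the element it represents.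
  _∩ʷ_ : Pred Term h → Pred Word s → Pred Word (h ⊔ s)
  H ∩ʷ S = (⟦_⟧ ⊢ H) ∩ S

  record Prime (S : Pred Word s) (H : Pred Term h) (w : Word) : Set (a ⊔ s ⊔ h) where
    field
      nonempty : w ≢ []
      member   : (H ∩ʷ S) w
      minimal  : ∀ {u} → ProperPrefix u w → u ≢ [] → ¬ (H ∩ʷ S) u

{-# OPTIONS --safe #-}

-- Acyclicity of the graphs E(w) extends from letters to words: there is no cycle
-- u₁, v₁, …, uₘ, vₘ with uᵢwvᵢ, uᵢ₊₁wvᵢ ∈ S, the uᵢ pairwise suffix-incomparable and the vᵢ
-- pairwise prefix-incomparable. In a shortest one, either all words on one side share the
-- letter next to w, which can be moved into w, or one can cut the cycle around a word not
-- having this letter; what remains is a cycle of letters.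
--
-- Join two prefixes p, r of words of X when pr⁻¹ ∈ X. The connected components are the states
-- of the Stallings automaton of ⟨X⟩. By the above, equivalent prefixes with the same last
-- letter b remain equivalent after removal of b, so paths in the automaton can be freely reduced;
-- and a path labelled by a word of S can be followed on prefixes of X themselves. Hence a word
-- of S in ⟨X⟩, which labels a loop at the empty prefix, is in X*.

module Submission where

open import Defs
open import Algebra.Definitions using (Involutive)
open import Data.Empty using (⊥; ⊥-elim)
open import Data.Fin.Base using (Fin)
import Data.Fin.Properties as Finₚ
open import Data.List.Base using (List; []; _∷_; [_]; _++_; _∷ʳ_; length; map; reverse; foldr)
open import Data.List.Membership.DecPropositional using (_∈?_)
open import Data.List.Membership.Propositional using (_∈_; find)
open import Data.List.Membership.Propositional.Properties using (∈-∃++)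
open import Data.List.Properties using (++-assoc; ++-identityʳ; ++-cancelʳ; foldr-++; length-++; length-map; map-++; map-∘; map-id-local; reverse-++; reverse-injective; reverse-involutive; reverse-map; unfold-reverse; ∷-injectiveʳ; ≡-dec)
open import Data.List.Relation.Binary.Infix.Heterogeneous using (Infix; there; _++ⁱ_; _ⁱ++_)
import Data.List.Relation.Binary.Infix.Heterogeneous.Properties as Infixₚ
import Data.List.Relation.Binary.Pointwise as Pointwise
open import Data.List.Relation.Binary.Prefix.Heterogeneous as Prefix using (Prefix; []; _∷_)
import Data.List.Relation.Binary.Prefix.Heterogeneous.Properties as Prefixₚ
open import Data.List.Relation.Binary.Suffix.Heterogeneous using (Suffix; here; _++ˢ_)
open import Data.List.Relation.Unary.All as All using (All; []; _∷_)
import Data.List.Relation.Unary.All.Properties as Allₚ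
open import Data.List.Relation.Unary.AllPairs as AllPairs using (AllPairs; []; _∷_)
import Data.List.Relation.Unary.AllPairs.Properties as AllPairsₚ
open import Data.List.Relation.Unary.Any as Any using (Any; here; there)
open import Data.List.Relation.Unary.Linked as Linked using (Linked; []; [-]; _∷_)
import Data.List.Relation.Unary.Linked.Properties as Linkedₚ
open import Data.List.Relation.Unary.Unique.Propositional using (Unique)
open import Data.Nat.Base using (ℕ; suc; _+_; _≤_; _<_; z≤n; s≤s)
open import Data.Nat.ListAction using (sum)
open import Data.Nat.ListAction.Properties using (sum-++)
import Data.Nat.Properties as ℕₚ
open import Data.Product.Base using (_×_; _,_; ∃; ∃₂; proj₁; proj₂)
open import Data.Sum.Base using (_⊎_; inj₁; inj₂; [_,_]′; swap)
open import Function.Base using (_∘_)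
open import Function.Bundles using (_↔_)
open import Function.Properties.Inverse using (↔⇒↣)
open import Level using (Level; _⊔_)
open import Relation.Binary.Construct.Closure.ReflexiveTransitive using (Star; ε; _◅_; _◅◅_)
open import Relation.Binary.Core using (Rel)
open import Relation.Binary.Definitions using (DecidableEquality; Symmetric)
open import Relation.Binary.PropositionalEquality using (_≡_; _≢_; refl; sym; trans; cong; cong₂; subst)
open import Relation.Nullary.Decidable using (yes; no; _×-dec_; _⊎-dec_; ¬?)
open import Relation.Nullary.Negation using (¬_; contradiction)
open import Relation.Unary using (Pred; Decidable; _⊆_; _∩_; _≐_)

-- Linked lists, pairwise relations and searches in lists

module _ {v r} {V : Set v} {R : Rel V r} where

  Linked-++⁻ : ∀ xs {y ys} → Linked R (xs ++ y ∷ ys) → Linked R (xs ∷ʳ y) × Linked R (y ∷ ys)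
  Linked-++⁻ []           l       = [-] , l
  Linked-++⁻ (x ∷ [])     (e ∷ l) = e ∷ [-] , l
  Linked-++⁻ (x ∷ z ∷ xs) (e ∷ l) = let l₁ , l₂ = Linked-++⁻ (z ∷ xs) l in e ∷ l₁ , l₂

  Linked-++⁺ : ∀ xs {y ys} → Linked R (xs ∷ʳ y) → Linked R (y ∷ ys) → Linked R (xs ++ y ∷ ys)
  Linked-++⁺ []           _       l = l
  Linked-++⁺ (x ∷ [])     (e ∷ _) l = e ∷ l
  Linked-++⁺ (x ∷ z ∷ xs) (e ∷ k) l = e ∷ Linked-++⁺ (z ∷ xs) k l

  Linked-replaceHead : ∀ {x y xs} → (∀ {z} → R x z → R y z) → Linked R (x ∷ xs) → Linked R (y ∷ xs)
  Linked-replaceHead f [-]     = [-]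
  Linked-replaceHead f (e ∷ l) = f e ∷ l

  Linked-replaceLast : ∀ {x y} → (∀ {z} → R z x → R z y) → ∀ xs → Linked R (xs ∷ʳ x) → Linked R (xs ∷ʳ y)
  Linked-replaceLast f []           [-]       = [-]
  Linked-replaceLast f (z ∷ [])     (e ∷ [-]) = f e ∷ [-]
  Linked-replaceLast f (z ∷ w ∷ xs) (e ∷ l)   = e ∷ Linked-replaceLast f (w ∷ xs) l

  AllPairs-++⁻ : ∀ xs {ys} → AllPairs R (xs ++ ys) →
    AllPairs R xs × AllPairs R ys × All (λ x → All (R x) ys) xs
  AllPairs-++⁻ []       p       = [] , p , []
  AllPairs-++⁻ (x ∷ xs) (q ∷ p) =
    let p₁ , p₂ , p₃ = AllPairs-++⁻ xs p
    in Allₚ.++⁻ˡ xs q ∷ p₁ , p₂ , Allₚ.++⁻ʳ xs q ∷ p₃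

  AllPairs-++-comm : Symmetric R → ∀ xs {ys} → AllPairs R (xs ++ ys) → AllPairs R (ys ++ xs)
  AllPairs-++-comm sym xs p =
    let p₁ , p₂ , p₃ = AllPairs-++⁻ xs p
    in AllPairsₚ.++⁺ p₂ p₁ (All.map (All.map sym) (Allₚ.All-swap p₃))

  Linked-rotate : ∀ {x} xs {y ys} →
    Linked R (x ∷ (xs ++ y ∷ ys) ∷ʳ x) → Linked R (y ∷ (ys ++ x ∷ xs) ∷ʳ y)
  Linked-rotate {x} xs {y} {ys} l rewrite ++-assoc xs (y ∷ ys) [ x ] | ++-assoc ys (x ∷ xs) [ y ] =
    let l₁ , l₂ = Linked-++⁻ (x ∷ xs) l in Linked-++⁺ (y ∷ ys) l₂ l₁

module _ {v p} {V : Set v} {P : Pred V p} (P? : Decidable P) where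

  -- The sentinel `y` guarantees a hit. The splitting of `xs` itself is recorded too, so that the
  -- entries before the hit are known to come from `xs` even when the hit is the sentinel.
  first : ∀ xs {y} → P y → ∃₂ λ xs₁ z → ∃₂ λ rest xs₂ →
    xs ∷ʳ y ≡ xs₁ ++ z ∷ rest × P z × All (¬_ ∘ P) xs₁ × xs ≡ xs₁ ++ xs₂
  first []       py = [] , _ , _ , [] , refl , py , [] , refl
  first (x ∷ xs) py with P? x
  ... | yes px = [] , x , _ , x ∷ xs , refl , px , [] , refl
  ... | no ¬px =
    let xs₁ , z , rest , xs₂ , eq , pz , ¬ps , eq′ = first xs py
    in x ∷ xs₁ , z , rest , xs₂ , cong (x ∷_) eq , pz , ¬px ∷ ¬ps , cong (x ∷_) eq′

  last : ∀ {x} → P x → ∀ xs → ∃₂ λ rest z → ∃₂ λ xs₁ xs₂ →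
    x ∷ xs ≡ rest ++ z ∷ xs₂ × P z × All (¬_ ∘ P) xs₂ × xs ≡ xs₁ ++ xs₂
  last px []       = [] , _ , [] , [] , refl , px , [] , refl
  last {x} px (y ∷ xs) with P? y
  ... | yes py =
    let rest , z , xs₁ , xs₂ , eq , pz , ¬ps , eq′ = last py xs
    in x ∷ rest , z , y ∷ xs₁ , xs₂ , cong (x ∷_) eq , pz , ¬ps , cong (y ∷_) eq′
  ... | no ¬py with last px xs
  ...   | [] , z , xs₁ , xs₂ , refl , pz , ¬ps , _ =
    [] , x , [] , y ∷ xs , refl , px , ¬py ∷ ¬ps , refl
  ...   | _ ∷ rest , z , xs₁ , xs₂ , eq , pz , ¬ps , eq′ =
    x ∷ y ∷ rest , z , y ∷ xs₁ , xs₂ , cong (λ l → x ∷ y ∷ l) (∷-injectiveʳ eq) , pz , ¬ps , cong (y ∷_) eq′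

  first-Any : ∀ {xs} → Any P xs → ∃₂ λ xs₁ z → ∃ λ xs₂ → xs ≡ xs₁ ++ z ∷ xs₂ × P z × All (¬_ ∘ P) xs₁
  first-Any any with find any
  ... | y , y∈xs , py with ∈-∃++ y∈xs
  ...   | ys , zs , refl with first ys py
  ...     | xs₁ , z , rest , _ , eq , pz , ¬ps , _ =
    xs₁ , z , rest ++ zs , trans (sym (++-assoc ys [ y ] zs)) (trans (cong (_++ zs) eq) (++-assoc xs₁ _ zs)) , pz , ¬ps

-- Comparability of words

module _ {a} {A : Set a} where

  infix 4 _∥_ _#_

  _∥_ _#_ : Rel (List A) a
  u ∥ v = Prefix _≡_ u v ⊎ Prefix _≡_ v u
  u # v = ¬ (u ∥ v)

  #-sym : Symmetric _#_
  #-sym u#v = u#v ∘ swap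

  infix-++ : ∀ us v {ws : List A} → Infix _≡_ v (us ++ v ++ ws)
  infix-++ us v = us ++ⁱ (Infixₚ.fromPointwise (Pointwise.≡⇒Pointwise-≡ refl) ⁱ++ _)

-- Cycles of words around a central word

data Side : Set where
  left right : Side

_≟ˢ_ : DecidableEquality Side
left  ≟ˢ left  = yes refl
left  ≟ˢ right = no λ ()
right ≟ˢ left  = no λ ()
right ≟ˢ right = yes refl

opposite : Side → Side
opposite left  = right
opposite right = left

module ExtensionCycles {a s} {A : Set a} (_≟_ : DecidableEquality A)
                       {S : Pred (List A) s} (acyclicS : Words.Acyclic A S) where
  open Words A
  open Acyclic acyclicS
  open Biextendable biextendable
  open Factorial factorial

  S-factor : ∀ us v {ws} → S (us ++ v ++ ws) → S v
  S-factor us v = factors (infix-++ us v)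

  -- A left word is stored from right to left: on both sides the head is the
  -- letter next to the central word, and comparability is that of prefixes.
  SidedWord : Set a
  SidedWord = Side × Word

  Apart : Rel SidedWord a
  Apart (c , u) (d , v) = c ≡ d → u # v

  Apart-sym : Symmetric Apart
  Apart-sym p eq = #-sym (p (sym eq))

  data Adj (w : Word) : Rel SidedWord (a ⊔ s) where
    leftRight : ∀ {u v} → S (reverse u ++ w ++ v) → Adj w (left , u) (right , v)
    rightLeft : ∀ {u v} → S (reverse u ++ w ++ v) → Adj w (right , v) (left , u)

  Adj-sym : ∀ {w} → Symmetric (Adj w)
  Adj-sym (leftRight q) = rightLeft q
  Adj-sym (rightLeft q) = leftRight q

  Adj-opposite : ∀ {w x y} → Adj w x y → proj₁ y ≡ opposite (proj₁ x)
  Adj-opposite (leftRight _) = refl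
  Adj-opposite (rightLeft _) = refl

  -- Incomparability, which for single letters is distinctness, excludes trivial cycles: if `bacd`
  -- is in `S`, then `a`, `ba` on the left and `c`, `cd` on the right of the empty word give a
  -- closed walk through four distinct vertices.
  record SimpleCycle (w : Word) (x : SidedWord) (xs : List SidedWord) : Set (a ⊔ s) where
    constructor cycle
    field
      size   : 3 ≤ length (x ∷ xs)
      apart  : AllPairs Apart (x ∷ xs)
      closed : Linked (Adj w) (x ∷ xs ∷ʳ x)

  Adj-truncateˡ : ∀ {w c u y b} → Adj w (c , b ∷ u) y → Adj w (c , [ b ]) y
  Adj-truncateˡ {w} {u = u} {b = b} (leftRight {v = v} q) =
    leftRight (S-factor (reverse u) (b ∷ w ++ v)
      (subst S (trans (cong (_++ w ++ v) (unfold-reverse b u))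
               (trans (++-assoc (reverse u) [ b ] (w ++ v)) (cong (reverse u ++_) (sym (++-identityʳ _))))) q))
  Adj-truncateˡ {w} {u = u} {b = b} (rightLeft {u = v} q) =
    rightLeft (S-factor [] (reverse v ++ w ++ [ b ])
      (subst S (sym (trans (++-assoc (reverse v) (w ++ [ b ]) u) (cong (reverse v ++_) (++-assoc w [ b ] u)))) q))

  Adj-truncateʳ : ∀ {w c u x b} → Adj w x (c , b ∷ u) → Adj w x (c , [ b ])
  Adj-truncateʳ = Adj-sym ∘ Adj-truncateˡ ∘ Adj-sym

  -- The pieces `us` and `vs` serve to show that rotation preserves `total`.
  rotate : ∀ {w x xs} ys {z zs} → x ∷ xs ≡ ys ++ z ∷ zs → SimpleCycle w x xs →
    ∃ λ xs′ → SimpleCycle w z xs′ × ∃₂ λ us vs → x ∷ xs ≡ us ++ vs × z ∷ xs′ ≡ vs ++ us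
  rotate []       refl c = _ , c , [] , _ , refl , sym (++-identityʳ _)
  rotate {xs = xs} (y ∷ ys) {z} {zs} refl (cycle s p l) =
    zs ++ y ∷ ys ,
    cycle (ℕₚ.≤-trans s (ℕₚ.≤-reflexive (cong suc len)))
          (AllPairs-++-comm Apart-sym (y ∷ ys) p) (Linked-rotate ys l) ,
    y ∷ ys , z ∷ zs , refl , refl
    where
    len : length (ys ++ z ∷ zs) ≡ length (zs ++ y ∷ ys)
    len = ℕₚ.suc-injective (trans (length-++ (y ∷ ys)) (trans (ℕₚ.+-comm (length (y ∷ ys)) _) (sym (length-++ (z ∷ zs)))))

  total : List SidedWord → ℕ
  total = sum ∘ map (length ∘ proj₂)

  total-++ : ∀ xs ys → total (xs ++ ys) ≡ total xs + total ys
  total-++ xs ys = trans (cong sum (map-++ _ xs ys)) (sum-++ (map _ xs) _)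

  push : Side → A → SidedWord → SidedWord
  push left  b (left  , u) = left  , b ∷ u
  push left  b (right , u) = right , u
  push right b (left  , u) = left  , u
  push right b (right , u) = right , b ∷ u

  extendCentre : Side → A → Word → Word
  extendCentre left  b w = b ∷ w
  extendCentre right b w = w ∷ʳ b

  -- The word of `S` behind the edge stays the same; only the border of the centre moves across `b`.
  Adj-push⁻ : ∀ c b {w x y} → Adj w (push c b x) (push c b y) → Adj (extendCentre c b w) x y
  Adj-push⁻ left b {w} {left , u} {right , v} (leftRight q) = leftRight (subst S
    (trans (cong (_++ w ++ v) (unfold-reverse b u)) (++-assoc (reverse u) [ b ] _)) q)
  Adj-push⁻ left b {w} {right , v} {left , u} (rightLeft q) = rightLeft (subst S
    (trans (cong (_++ w ++ v) (unfold-reverse b u)) (++-assoc (reverse u) [ b ] _)) q)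
  Adj-push⁻ right b {w} {left , u} {right , v} (leftRight q) = leftRight (subst S
    (cong (reverse u ++_) (sym (++-assoc w [ b ] v))) q)
  Adj-push⁻ right b {w} {right , v} {left , u} (rightLeft q) = rightLeft (subst S
    (cong (reverse u ++_) (sym (++-assoc w [ b ] v))) q)

  Apart-push⁻ : ∀ c b {x y} → Apart (push c b x) (push c b y) → Apart x y
  Apart-push⁻ left  b {left  , u} p refl = p refl ∘ [ inj₁ ∘ (refl ∷_) , inj₂ ∘ (refl ∷_) ]′
  Apart-push⁻ left  b {right , u} p refl = p refl
  Apart-push⁻ right b {left  , u} p refl = p refl
  Apart-push⁻ right b {right , u} p refl = p refl ∘ [ inj₁ ∘ (refl ∷_) , inj₂ ∘ (refl ∷_) ]′

  total-push : ∀ c b xs → total xs ≤ total (map (push c b) xs)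
  total-push c b []       = z≤n
  total-push c b (x ∷ xs) = ℕₚ.+-mono-≤ (grow c x) (total-push c b xs)
    where
    grow : ∀ c x → length (proj₂ x) ≤ length (proj₂ (push c b x))
    grow left  (left  , u) = ℕₚ.n≤1+n _
    grow left  (right , u) = ℕₚ.≤-refl
    grow right (left  , u) = ℕₚ.≤-refl
    grow right (right , u) = ℕₚ.n≤1+n _

  Begins : Side → A → Pred SidedWord a
  Begins c b x = ∃ λ u → x ≡ (c , b ∷ u)

  begins? : ∀ c b → Decidable (Begins c b)
  begins? c b (d , [])    = no λ ()
  begins? c b (d , e ∷ u) with c ≟ˢ d | b ≟ e
  ... | yes refl | yes refl = yes (u , refl)
  ... | no c≢d   | _        = no λ { (_ , refl) → c≢d refl }
  ... | _        | no b≢e   = no λ { (_ , refl) → b≢e refl }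

  Stray : Side → A → Pred SidedWord a
  Stray c b x = proj₁ x ≡ c × ¬ Begins c b x

  unpush : ∀ c b xs → All (¬_ ∘ Stray c b) xs → ∃ λ ys → xs ≡ map (push c b) ys
  unpush c b []       []       = [] , refl
  unpush c b (x ∷ xs) (p ∷ ps) =
    let y , eq = one c x p ; ys , eqs = unpush c b xs ps in y ∷ ys , cong₂ _∷_ eq eqs
    where
    one : ∀ c x → ¬ Stray c b x → ∃ λ y → x ≡ push c b y
    one c x p with begins? c b x
    one left  x         p | yes (u , eq) = (left , u) , eq
    one right x         p | yes (u , eq) = (right , u) , eq
    one left  (left  , u) p | no ¬q = contradiction (refl , ¬q) p
    one left  (right , u) p | no ¬q = (right , u) , refl
    one right (left  , u) p | no ¬q = (left , u) , refl
    one right (right , u) p | no ¬q = contradiction (refl , ¬q) p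

  -- Without stray words all words of the side `c` begin with `b`, which can be moved into the
  -- centre. The first word gets shorter and no other word grows.
  strip : ∀ {w c b u xs} → All (¬_ ∘ Stray c b) xs → SimpleCycle w (c , b ∷ u) xs →
    ∃ λ ys → SimpleCycle (extendCentre c b w) (c , u) ys × total ((c , u) ∷ ys) < total ((c , b ∷ u) ∷ xs)
  strip {w} {c} {b} {u} {xs} ¬stray (cycle s p l) with unpush c b xs ¬stray
  ... | ys , refl = ys ,
    cycle (subst (λ k → 3 ≤ suc k) (length-map (push c b) ys) s)
          (AllPairs.map (Apart-push⁻ c b) (AllPairsₚ.map⁻ (subst (λ x → AllPairs Apart (x ∷ _)) (is-push c) p)))
          (Linked.map (Adj-push⁻ c b) (Linkedₚ.map⁻ (subst (Linked (Adj w)) shape l))) ,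
    s≤s (ℕₚ.+-monoʳ-≤ (length u) (total-push c b ys))
    where
    is-push : ∀ c → (c , b ∷ u) ≡ push c b (c , u)
    is-push left  = refl
    is-push right = refl
    shape : (c , b ∷ u) ∷ map (push c b) ys ∷ʳ (c , b ∷ u) ≡ map (push c b) ((c , u) ∷ ys ∷ʳ (c , u))
    shape rewrite is-push c = cong (_ ∷_) (sym (map-++ (push c b) ys _))

  -- A word comparable with `[ b ]` is empty or begins with `b`, and the empty word is already
  -- comparable with `b ∷ u`.
  Apart-truncate : ∀ {c b u y} → Apart (c , b ∷ u) y → ¬ Begins c b y → Apart (c , [ b ]) y
  Apart-truncate {y = _ , []}    p ¬q refl _               = p refl (inj₂ [])
  Apart-truncate {y = _ , _ ∷ _} p ¬q refl (inj₁ (refl ∷ _)) = ¬q (_ , refl)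
  Apart-truncate {y = _ , _ ∷ _} p ¬q refl (inj₂ (refl ∷ _)) = ¬q (_ , refl)

  -- Around a word y of the side c not beginning with b, the cycle is cut at the nearest words
  -- of this side beginning with b on either side of y, and both are replaced by b.
  shortcut : ∀ {w c b d u xs} → Any (Stray c b) xs → SimpleCycle w (c , b ∷ d ∷ u) xs →
    ∃ λ ys → SimpleCycle w (c , [ b ]) ys × total ((c , [ b ]) ∷ ys) < total ((c , b ∷ d ∷ u) ∷ xs)
  shortcut {w} {c} {b} {d} {u} stray (cycle s (px ∷ p) l) with find stray
  ... | y , y∈xs , c≡ , ¬by with ∈-∃++ y∈xs
  ...   | ys , zs , refl
    -- The starting word begins with `b` and is the sentinel of both searches, at its departure and
    -- at its return.
    with last (begins? c b) (_ , refl) ys | first (begins? c b) zs (d ∷ u , refl)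
  ... | rest , _ , ys₁ , ys₂ , eqy , (_ , refl) , ¬ys , refl
      | zs₁ , _ , rest′ , zs₂ , eqz , (_ , refl) , ¬zs , refl =
    ys₂ ++ y ∷ zs₁ , cycle (big ys₂ zs₁ middle)
      (All.zipWith (λ (q , r) → Apart-truncate q r)
        (Allₚ.++⁺ (Allₚ.++⁻ʳ ys₁ (Allₚ.++⁻ˡ (ys₁ ++ ys₂) px)) (All.head px′ ∷ Allₚ.++⁻ˡ zs₁ (All.tail px′)) ,
         Allₚ.++⁺ ¬ys (¬by ∷ ¬zs))
       ∷ proj₁ (AllPairs-++⁻ (ys₂ ++ y ∷ zs₁) (subst (AllPairs Apart) (sym (++-assoc ys₂ (y ∷ zs₁) zs₂))
           (proj₁ (proj₂ (AllPairs-++⁻ ys₁ (subst (AllPairs Apart) (++-assoc ys₁ ys₂ _) p)))))))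
      -- The ends of `middle` may be different words; truncated to `[ b ]` they coincide and the
      -- path closes up.
      (Linked-replaceHead Adj-truncateˡ (Linked-replaceLast Adj-truncateʳ (_ ∷ ys₂ ++ y ∷ zs₁) (subst (λ k → Linked (Adj w) (_ ∷ k)) (sym (++-assoc ys₂ (y ∷ zs₁) _)) middle))) ,
    smaller
    where
    px′ = Allₚ.++⁻ʳ (ys₁ ++ ys₂) px

    middle : Linked (Adj w) ((c , b ∷ _) ∷ ys₂ ++ y ∷ zs₁ ∷ʳ (c , b ∷ _))
    middle =
      let l₁ , l₂ = Linked-++⁻ (_ ∷ ys₁ ++ ys₂) (subst (Linked (Adj w)) (cong (_ ∷_) (++-assoc (ys₁ ++ ys₂) (y ∷ zs₁ ++ zs₂) _)) l)
          k₁ = proj₂ (Linked-++⁻ rest (subst (Linked (Adj w)) (trans (cong (_∷ʳ y) eqy) (++-assoc rest _ [ y ])) l₁))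
          k₂ = proj₁ (Linked-++⁻ (y ∷ zs₁) (subst (Linked (Adj w)) (cong (y ∷_) eqz) l₂))
      in Linked-++⁺ (_ ∷ ys₂) k₁ k₂

    notAdj : ∀ {v} → ¬ Adj w (c , v) y
    notAdj e = absurd c (trans (sym c≡) (Adj-opposite e))
      where
      absurd : ∀ c → ¬ c ≡ opposite c
      absurd left  ()
      absurd right ()

    -- As `y` lies on the side of the end words, it is adjacent to neither, so `ys₂` is not empty.
    big : ∀ {u v} ys₂ zs₁ → Linked (Adj w) ((c , b ∷ u) ∷ ys₂ ++ y ∷ zs₁ ∷ʳ (c , b ∷ v)) →
      3 ≤ suc (length (ys₂ ++ y ∷ zs₁))
    big []        zs₁ (e ∷ _) = contradiction e notAdj
    big (k ∷ ys₂) zs₁ _       = s≤s (s≤s (subst (1 ≤_) (sym (trans (length-++ ys₂) (ℕₚ.+-suc _ _))) (s≤s z≤n)))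

    smaller : total ((c , [ b ]) ∷ ys₂ ++ y ∷ zs₁) < total ((c , b ∷ d ∷ u) ∷ (ys₁ ++ ys₂) ++ y ∷ zs₁ ++ zs₂)
    smaller rewrite total-++ ys₂ (y ∷ zs₁) | total-++ (ys₁ ++ ys₂) (y ∷ zs₁ ++ zs₂)
                  | total-++ ys₁ ys₂ | total-++ zs₁ zs₂ =
      s≤s (s≤s (ℕₚ.≤-trans
        (ℕₚ.+-mono-≤ (ℕₚ.m≤n+m (total ys₂) (total ys₁))
                     (ℕₚ.+-monoʳ-≤ (length (proj₂ y)) (ℕₚ.m≤m+n (total zs₁) (total zs₂))))
        (ℕₚ.m≤n+m _ (length u))))

  letter : A ⊎ A → SidedWord
  letter (inj₁ b) = left  , [ b ]
  letter (inj₂ b) = right , [ b ]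

  IsLetter : Pred SidedWord a
  IsLetter x = ∃ λ b → x ≡ letter b

  isLetter? : Decidable IsLetter
  isLetter? (c     , [])        = no λ { (inj₁ _ , ()) ; (inj₂ _ , ()) }
  isLetter? (left  , b ∷ [])    = yes (inj₁ b , refl)
  isLetter? (right , b ∷ [])    = yes (inj₂ b , refl)
  isLetter? (c     , _ ∷ _ ∷ _) = no λ { (inj₁ _ , ()) ; (inj₂ _ , ()) }

  unletter : ∀ xs → All IsLetter xs → ∃ λ ys → xs ≡ map letter ys
  unletter []       []              = [] , refl
  unletter (x ∷ xs) ((b , eq) ∷ ps) = let ys , eqs = unletter xs ps in b ∷ ys , cong₂ _∷_ eq eqs

  Adj-letter⁻ : ∀ {w x y} → Adj w (letter x) (letter y) → ExtensionAdj S w x y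
  Adj-letter⁻ {x = inj₁ _} {inj₂ _} (leftRight q) = leftRight q
  Adj-letter⁻ {x = inj₂ _} {inj₁ _} (rightLeft q) = rightLeft q

  Apart-letter⁻ : ∀ {x y} → Apart (letter x) (letter y) → x ≢ y
  Apart-letter⁻ p refl = p refl (inj₁ (refl′ _))
    where
    refl′ : ∀ (w : Word) → Prefix _≡_ w w
    refl′ []      = []
    refl′ (b ∷ w) = refl ∷ refl′ w

  centre∈S : ∀ {w x y} → ExtensionAdj S w x y → S w
  centre∈S (leftRight {b} q) = S-factor [ b ] _ q
  centre∈S (rightLeft {b} q) = S-factor [ b ] _ q

  source-vertex : ∀ {w x y} → ExtensionAdj S w x y → Graph.Vertex (extensionGraph S w) x
  source-vertex {w} (leftRight {b} q)     = S-factor [] (b ∷ w) q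
  source-vertex {w} (rightLeft {b} {d} q) =
    S-factor [ b ] (w ∷ʳ d) (subst S (cong (b ∷_) (sym (++-identityʳ _))) q)

  sources : ∀ {w} x xs {y} → Linked (ExtensionAdj S w) (x ∷ xs ∷ʳ y) →
    All (Graph.Vertex (extensionGraph S w)) (x ∷ xs)
  sources x []        (e ∷ _) = source-vertex e ∷ []
  sources x (x′ ∷ xs) (e ∷ l) = source-vertex e ∷ sources x′ xs l

  no-letterCycle : ∀ {w} x xs → ¬ SimpleCycle w (letter x) (map letter xs)
  no-letterCycle {w} x xs (cycle s p l) =
    acyclic (edge l′) record
      { v        = x
      ; vs       = xs
      ; vertices = sources x xs l′
      ; distinct = AllPairs.map Apart-letter⁻ (AllPairsₚ.map⁻ p)
      ; size     = subst (λ k → 3 ≤ suc k) (length-map letter xs) s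
      ; closed   = l′
      }
    where
    l′ : Linked (ExtensionAdj S w) (x ∷ xs ∷ʳ x)
    l′ = Linked.map Adj-letter⁻ (Linkedₚ.map⁻ (subst (Linked (Adj w)) (cong (letter x ∷_) (sym (map-++ letter xs [ x ]))) l))
    edge : ∀ {xs} → Linked (ExtensionAdj S w) (x ∷ xs ∷ʳ x) → S w
    edge {[]}    (e ∷ _) = centre∈S e
    edge {_ ∷ _} (e ∷ _) = centre∈S e

  -- Sides alternate, so two steps further on there is a word of the same side, and the empty word
  -- is a prefix of it.
  no-empty : ∀ {w c xs} → ¬ SimpleCycle w (c , []) xs
  no-empty {c = c} {xs = y ∷ z ∷ _} (cycle _ ((_ ∷ p ∷ _) ∷ _) (e ∷ e′ ∷ _)) =
    p (sym (trans (Adj-opposite e′) (trans (cong opposite (Adj-opposite e)) (involutive c)))) (inj₁ [])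
    where
    involutive : ∀ c → opposite (opposite c) ≡ c
    involutive left  = refl
    involutive right = refl
  no-empty {xs = []}    (cycle (s≤s ()) _ _)
  no-empty {xs = _ ∷ []} (cycle (s≤s (s≤s ())) _ _)

  -- Descent on `total`, bounded by `n`: a cycle not made of letters is rotated to start with a word
  -- of another length, which is excluded if empty and otherwise allows `shortcut` or `strip`.
  no-simpleCycle : ∀ n {w x xs} → total (x ∷ xs) < n → ¬ SimpleCycle w x xs
  no-simpleCycle (suc n) {w} {x} {xs} (s≤s t≤n) C with All.all? isLetter? (x ∷ xs)
  ... | yes letters with unletter (x ∷ xs) letters
  ...   | y ∷ ys , refl = no-letterCycle y ys C
  no-simpleCycle (suc n) {w} {x} {xs} (s≤s t≤n) C | no ¬letters
    with find (Allₚ.¬All⇒Any¬ isLetter? _ ¬letters)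
  ... | z , z∈ , ¬letter with ∈-∃++ z∈
  ...   | us , vs , eq with rotate us eq C
  ...     | xs′ , C′ , ps , qs , eqx , eqz = descend z ¬letter C′ t′
    where
    t′ : total (z ∷ xs′) ≤ n
    t′ = ℕₚ.≤-trans (ℕₚ.≤-reflexive (trans (cong total eqz) (trans (total-++ qs ps)
           (trans (ℕₚ.+-comm (total qs) _) (sym (trans (cong total eqx) (total-++ ps qs))))))) t≤n
    descend : ∀ z → ¬ IsLetter z → SimpleCycle w z xs′ → total (z ∷ xs′) ≤ n → ⊥
    descend (c     , [])        _  C t = no-empty C
    descend (left  , b ∷ [])    ¬p C t = ¬p (inj₁ b , refl)
    descend (right , b ∷ [])    ¬p C t = ¬p (inj₂ b , refl)
    descend (c , b ∷ d ∷ u)     _  C t with Any.any? (λ x → (proj₁ x ≟ˢ c) ×-dec ¬? (begins? c b x)) xs′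
    ... | yes stray = let _ , C′ , t′ = shortcut stray C in no-simpleCycle n (ℕₚ.<-≤-trans t′ t) C′
    ... | no ¬stray = let _ , C′ , t′ = strip (Allₚ.¬Any⇒All¬ xs′ ¬stray) C in no-simpleCycle n (ℕₚ.<-≤-trans t′ t) C′

-- Inverses of words

module Inverses {a} {A : Set a} (θ : A → A) (θ-involutive : ∀ b → θ (θ b) ≡ b) where
  open Words A
  open Laminary θ

  map-θ-involutive : ∀ w → map θ (map θ w) ≡ w
  map-θ-involutive w = trans (sym (map-∘ w)) (map-id-local (All.universal θ-involutive w))

  θ-injective : ∀ {b d} → θ b ≡ θ d → b ≡ d
  θ-injective eq = trans (sym (θ-involutive _)) (trans (cong θ eq) (θ-involutive _))

  inverse-++ : ∀ u v → inverse (u ++ v) ≡ inverse v ++ inverse u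
  inverse-++ u v = trans (cong reverse (map-++ θ u v)) (reverse-++ (map θ u) (map θ v))

  inverse-reverse : ∀ u → inverse (reverse u) ≡ map θ u
  inverse-reverse u = trans (cong reverse (reverse-map θ u)) (reverse-involutive (map θ u))

  inverse-involutive : ∀ u → inverse (inverse u) ≡ u
  inverse-involutive u = trans (inverse-reverse (map θ u)) (map-θ-involutive u)

  inverse-join : ∀ u v → inverse (reverse u ++ map θ v) ≡ reverse v ++ map θ u
  inverse-join u v = trans (inverse-++ (reverse u) (map θ v))
    (cong₂ _++_ (cong reverse (map-θ-involutive v)) (inverse-reverse u))

-- Cycles of words in a laminary set

module LaminaryCycles {a s} {A : Set a} (_≟_ : DecidableEquality A)
    (θ : A → A) (θ-involutive : ∀ b → θ (θ b) ≡ b)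
    {S : Pred (List A) s} (laminary : Laminary.LaminarySet θ S) (acyclicS : Words.Acyclic A S) where
  open Words A
  open Laminary θ
  open Inverses θ θ-involutive
  open LaminarySet laminary using (reduced; symmetric)
  open ExtensionCycles _≟_ acyclicS

  infix 4 _⌢_

  -- If p and r, read backwards, represent g and h, this says that g h⁻¹ is in S.
  _⌢_ : Rel Word s
  p ⌢ r = S (reverse p ++ map θ r)

  ⌢-sym : Symmetric _⌢_
  ⌢-sym {p} {r} q = subst S (inverse-join p r) (symmetric q)

  ⌢-prefixˡ : ∀ {p p′ r} → Prefix _≡_ p′ p → p ⌢ r → p′ ⌢ r
  ⌢-prefixˡ {p′ = p′} {r} pre q with Prefix.toView pre
  ... | eq Prefix.++ t with refl ← Pointwise.Pointwise-≡⇒≡ eq =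
    S-factor (reverse t) (reverse p′ ++ map θ r) (subst S
      (trans (cong (_++ map θ r) (reverse-++ p′ t))
      (trans (++-assoc (reverse t) (reverse p′) (map θ r)) (cong (reverse t ++_) (sym (++-identityʳ _))))) q)

  ⌢-prefixʳ : ∀ {p r r′} → Prefix _≡_ r′ r → p ⌢ r → p ⌢ r′
  ⌢-prefixʳ {p} {r} {r′} pre q = ⌢-sym {r′} {p} (⌢-prefixˡ {r} {r′} {p} pre (⌢-sym {p} {r} q))

  -- The two heads would meet as `b` followed by `θ b`, against reducedness.
  ⌢-sameHead : ∀ {b p r} → ¬ (b ∷ p) ⌢ (b ∷ r)
  ⌢-sameHead {b} {p} {r} q = reduced q b (subst (Infix _≡_ (b ∷ θ b ∷ []))
    (sym (trans (cong (_++ θ b ∷ map θ r) (unfold-reverse b p)) (++-assoc (reverse p) [ b ] _)))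
    (infix-++ (reverse p) (b ∷ θ b ∷ [])))

  -- The two copies of a word in the bipartite double cover of the graph of `⌢`, placed around the
  -- empty centre. The right copy is spelled as the inverse.
  colour : Side → Word → SidedWord
  colour left  p = left  , p
  colour right p = right , map θ p

  colours : Side → List Word → List SidedWord
  colours c []       = []
  colours c (p ∷ ps) = colour c p ∷ colours (opposite c) ps

  sideAfter : Side → List Word → Side
  sideAfter c []       = c
  sideAfter c (_ ∷ ps) = sideAfter (opposite c) ps

  sideAfter-opposite : ∀ c ps → sideAfter (opposite c) ps ≡ opposite (sideAfter c ps)
  sideAfter-opposite c []       = refl
  sideAfter-opposite c (_ ∷ ps) = sideAfter-opposite (opposite c) ps

  colours-∷ʳ : ∀ c ps p → colours c (ps ∷ʳ p) ≡ colours c ps ∷ʳ colour (sideAfter c ps) p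
  colours-∷ʳ c []       p = refl
  colours-∷ʳ c (q ∷ ps) p = cong (colour c q ∷_) (colours-∷ʳ (opposite c) ps p)

  length-colours : ∀ c ps → length (colours c ps) ≡ length ps
  length-colours c []       = refl
  length-colours c (p ∷ ps) = cong suc (length-colours (opposite c) ps)

  colour-Adj : ∀ c {p r} → p ⌢ r → Adj [] (colour c p) (colour (opposite c) r)
  colour-Adj left          q = leftRight q
  colour-Adj right {p} {r} q = rightLeft (⌢-sym {p} {r} q)

  colours-Linked : ∀ c {ps} → Linked _⌢_ ps → Linked (Adj []) (colours c ps)
  colours-Linked c []          = []
  colours-Linked c [-]         = [-]
  colours-Linked c (_∷_ {x = p} {y = r} e l) = colour-Adj c {p} {r} e ∷ colours-Linked (opposite c) l

  colour-Apart : ∀ c d {p r} → p # r → Apart (colour c p) (colour d r)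
  colour-Apart left  left  p#r _ = p#r
  colour-Apart right right p#r _ = p#r ∘ [ inj₁ ∘ unmap , inj₂ ∘ unmap ]′
    where
    unmap : ∀ {p r} → Prefix _≡_ (map θ p) (map θ r) → Prefix _≡_ p r
    unmap = Prefix.map θ-injective ∘ Prefixₚ.map⁻ θ θ
  colour-Apart left  right p#r ()
  colour-Apart right left  p#r ()

  colours-All-Apart : ∀ c d {p ps} → All (p #_) ps → All (Apart (colour c p)) (colours d ps)
  colours-All-Apart c d []       = []
  colours-All-Apart c d (q ∷ qs) = colour-Apart c d q ∷ colours-All-Apart c (opposite d) qs

  colours-Apart : ∀ c {ps} → AllPairs _#_ ps → AllPairs Apart (colours c ps)
  colours-Apart c []       = []
  colours-Apart c (q ∷ qs) = colours-All-Apart c (opposite c) q ∷ colours-Apart (opposite c) qs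

  -- This compares the first round with the second: copies of one word lie on different sides, and
  -- different words are incomparable.
  colours-cross : ∀ c {ps} → AllPairs _#_ ps →
    All (λ x → All (Apart x) (colours (opposite c) ps)) (colours c ps)
  colours-cross c []       = []
  colours-cross c {p ∷ _} (q ∷ qs) =
    (twoSides c ∷ colours-All-Apart c _ q) ∷
    All.zipWith (λ (r , rs) → Apart-sym r ∷ rs)
      (colours-All-Apart (opposite c) (opposite c) q , colours-cross (opposite c) qs)
    where
    twoSides : ∀ c → Apart (colour c p) (colour (opposite c) p)
    twoSides left  ()
    twoSides right ()

  -- Colouring the words alternately gives a cycle of sided words; if the length is odd, one
  -- has to go round twice.
  no-wordCycle : ∀ p {ps} → 2 ≤ length ps → AllPairs _#_ (p ∷ ps) → ¬ Linked _⌢_ (p ∷ ps ∷ʳ p)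
  no-wordCycle p {ps} size apart closed with sideAfter left (p ∷ ps) in eq
  ... | left  = no-simpleCycle _ ℕₚ.≤-refl (cycle
    (s≤s (subst (2 ≤_) (sym (length-colours right ps)) size))
    (colours-Apart left apart)
    (subst (Linked (Adj [])) (trans (colours-∷ʳ left (p ∷ ps) p) (cong (λ c → colours left (p ∷ ps) ∷ʳ colour c p) eq))
      (colours-Linked left closed)))
  ... | right = no-simpleCycle _ ℕₚ.≤-refl (cycle
    (s≤s (ℕₚ.≤-trans (subst (2 ≤_) (sym (length-colours right ps)) size)
      (subst (length (colours right ps) ≤_) (sym (length-++ (colours right ps))) (ℕₚ.m≤m+n _ _))))
    (AllPairsₚ.++⁺ (colours-Apart left apart) (colours-Apart right apart) (colours-cross left apart))
    (subst (Linked (Adj [])) (sym (++-assoc (colours left (p ∷ ps)) (colours right (p ∷ ps)) _))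
      (Linked-++⁺ (colours left (p ∷ ps))
        (round left right eq) (round right left (trans (sideAfter-opposite left (p ∷ ps)) (cong opposite eq))))))
    where
    round : ∀ c d → sideAfter c (p ∷ ps) ≡ d → Linked (Adj []) (colours c (p ∷ ps) ∷ʳ colour d p)
    round c d eq = subst (Linked (Adj [])) (trans (colours-∷ʳ c (p ∷ ps) p) (cong (λ d → colours c (p ∷ ps) ∷ʳ colour d p) eq))
      (colours-Linked c closed)

-- Simple paths

module _ {v} {V : Set v} where

  data EndsIn (y : V) : List V → Set v where
    [-] : EndsIn y [ y ]
    _∷_ : ∀ x {xs} → EndsIn y xs → EndsIn y (x ∷ xs)

  EndsIn⇒∈ : ∀ {y xs} → EndsIn y xs → y ∈ xs
  EndsIn⇒∈ [-]     = here refl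
  EndsIn⇒∈ (_ ∷ e) = there (EndsIn⇒∈ e)

module _ {v r} {V : Set v} (_≟_ : DecidableEquality V) {R : Rel V r} where

  SimplePath : V → V → Set (v ⊔ r)
  SimplePath x y = ∃ λ xs → Linked R (x ∷ xs) × Unique (x ∷ xs) × EndsIn y (x ∷ xs)

  private
    suffixFrom : ∀ {x y zs} → x ∈ zs → Linked R zs → Unique zs → EndsIn y zs → SimplePath x y
    suffixFrom (here refl) l u e       = _ , l , u , e
    suffixFrom (there x∈) l (_ ∷ u) (_ ∷ e) = suffixFrom x∈ (Linked.tail l) u e

  -- Loop erasure: if `x` recurs later, only the part from that occurrence on is kept.
  simplePath : ∀ {x y} → Star R x y → SimplePath x y
  simplePath ε = [] , [-] , [] ∷ [] , [-]
  simplePath {x} (_◅_ {j = z} e es) with simplePath es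
  ... | zs , l , u , end with _∈?_ _≟_ x (z ∷ zs)
  ...   | yes x∈ = suffixFrom x∈ l u end
  ...   | no x∉  = z ∷ zs , e ∷ l , Allₚ.¬Any⇒All¬ _ x∉ ∷ u , x ∷ end

-- The folded automaton of a symmetric bifix code

module SymmetricBifixCode {a s x} {A : Set a} (_≟_ : DecidableEquality A)
    (θ : A → A) (θ-involutive : ∀ b → θ (θ b) ≡ b)
    {S : Pred (List A) s} (laminary : Laminary.LaminarySet θ S) (acyclicS : Words.Acyclic A S)
    {X : Pred (List A) x} (X-inverse : Laminary.ClosedUnderInverse θ X)
    (bifix : Words.BifixCode A X) (X⊆S : X ⊆ S) where
  open Words A
  open Laminary θ
  open Inverses θ θ-involutive
  open ExtensionCycles _≟_ acyclicS using (S-factor)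
  open LaminaryCycles _≟_ θ θ-involutive laminary acyclicS
  open BifixCode bifix using (nonempty; suffix)

  infix 4 _—_ _≈_

  -- Adjacency of the states of the folded flower automaton of X: a state is a prefix of a word
  -- of X read backwards, and two prefixes p, r with p r⁻¹ in X lead to the same coset.
  record _—_ (p r : Word) : Set x where
    constructor edge
    field
      join∈X : X (reverse p ++ map θ r)

  _≈_ : Rel Word (a ⊔ x)
  _≈_ = Star _—_

  —-sym : Symmetric _—_
  —-sym {p} {r} (edge q) = edge (subst X (inverse-join p r) (X-inverse q))

  —⇒⌢ : ∀ {p r} → p — r → p ⌢ r
  —⇒⌢ (edge q) = X⊆S q

  -- If `p` were a proper prefix of `p′`, then, words being stored backwards, one word of `X` would
  -- be a proper suffix of another.
  —-unique : ∀ {p p′ r} → p — r → p′ — r → p ≢ p′ → p # p′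
  —-unique {p} {p′} {r} e e′ p≢p′ = [ incomparable e e′ p≢p′ , incomparable e′ e (p≢p′ ∘ sym) ]′
    where
    incomparable : ∀ {p p′} → p — r → p′ — r → p ≢ p′ → ¬ Prefix _≡_ p p′
    incomparable {p} (edge q) (edge q′) p≢p′ pre with Prefix.toView pre
    ... | eq Prefix.++ t with refl ← Pointwise.Pointwise-≡⇒≡ eq = suffix q q′
      ( subst (λ w → Suffix _≡_ (reverse p ++ map θ r) w)
          (sym (trans (cong (_++ map θ r) (reverse-++ p t)) (++-assoc (reverse t) (reverse p) (map θ r))))
          (reverse t ++ˢ here (Pointwise.≡⇒Pointwise-≡ refl))
      , p≢p′ ∘ reverse-injective ∘ ++-cancelʳ _ _ _ )

  —-empty : ∀ {p r} → p — r → [] — r → p ≡ []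
  —-empty {[]}    _ _  = refl
  —-empty {b ∷ p} e e′ = contradiction (inj₂ []) (—-unique e e′ λ ())

  -- The word of `X` is the same, cut one letter further on.
  —-shift : ∀ {b p r} → p — (b ∷ r) → (θ b ∷ p) — r
  —-shift {b} {p} {r} (edge q) = edge (subst X
    (sym (trans (cong (_++ map θ r) (unfold-reverse (θ b) p)) (++-assoc (reverse p) [ θ b ] _))) q)

  —-unshift : ∀ {b p r} → (b ∷ p) — r → p — (θ b ∷ r)
  —-unshift e = —-sym (—-shift (—-sym e))

  #-nonempty : ∀ {p r : Word} → p # r → p ≢ []
  #-nonempty p#r refl = p#r (inj₁ [])

  -- Distinct neighbours of one vertex are incomparable, hence nonempty. This applies to `p` and `r`
  -- around `q`, and then along the walk.
  walk-nonempty : ∀ {p q r l} → Linked _—_ (p ∷ q ∷ r ∷ l) → Unique (p ∷ q ∷ r ∷ l) → q ≢ [] →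
    All (_≢ []) (p ∷ q ∷ r ∷ l)
  walk-nonempty {l = l} (e ∷ e′ ∷ es) ((_ ∷ p≢r ∷ _) ∷ u) q≢[] =
    #-nonempty p#r ∷ rest l es u
    where
    p#r = —-unique e (—-sym e′) p≢r
    r≢[] = #-nonempty (#-sym p#r)
    rest : ∀ l → Linked _—_ (_ ∷ l) → Unique (_ ∷ _ ∷ l) → All (_≢ []) (_ ∷ _ ∷ l)
    rest []      _  _ = q≢[] ∷ r≢[] ∷ []
    rest (_ ∷ _) es u = walk-nonempty (e′ ∷ es) u r≢[]

  -- Let `r` be the first word comparable with `p`. If they are adjacent, their common first letter
  -- contradicts reducedness; if one vertex lies between, `—-unique` applies. Otherwise the shorter
  -- of the two, put at both ends, closes the walk to a forbidden cycle of words.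
  walk-# : ∀ {l} → Linked _—_ l → Unique l → All (_≢ []) l → AllPairs _#_ l
  walk-# [] _ _ = []
  walk-# {p ∷ l} es (u ∷ us) (p≢[] ∷ ne) with walk-# (Linked.tail es) us ne
                                        | Any.any? (λ r → Prefixₚ.prefix? _≟_ p r ⊎-dec Prefixₚ.prefix? _≟_ r p) l
  ... | ih | no ¬any = Allₚ.¬Any⇒All¬ l ¬any ∷ ih
  ... | ih | yes any with first-Any (λ r → Prefixₚ.prefix? _≟_ p r ⊎-dec Prefixₚ.prefix? _≟_ r p) any
  ...   | l₁ , r , l₂ , refl , p∥r , p#l₁ = ⊥-elim (bad l₁ es u ne ih p∥r p#l₁)
    where
    bad : ∀ {r l₂} l₁ → Linked _—_ (p ∷ l₁ ++ r ∷ l₂) → All (p ≢_) (l₁ ++ r ∷ l₂) → All (_≢ []) (l₁ ++ r ∷ l₂) →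
      AllPairs _#_ (l₁ ++ r ∷ l₂) → p ∥ r → All (p #_) l₁ → ⊥
    bad [] (e ∷ _) _ (r≢[] ∷ _) _ p∥r _ = distinctHeads p≢[] r≢[] p∥r (—⇒⌢ e)
      where
      distinctHeads : ∀ {p r} → p ≢ [] → r ≢ [] → p ∥ r → ¬ p ⌢ r
      distinctHeads p≢[] r≢[] (inj₁ [])         = contradiction refl p≢[]
      distinctHeads p≢[] r≢[] (inj₂ [])         = contradiction refl r≢[]
      distinctHeads p≢[] r≢[] (inj₁ (_∷_ {as = p} {bs = r} refl _)) = ⌢-sameHead {p = p} {r}
      distinctHeads p≢[] r≢[] (inj₂ (_∷_ {as = r} {bs = p} refl _)) = ⌢-sameHead {p = p} {r}
    bad (q ∷ []) (e ∷ e′ ∷ _) (_ ∷ p≢r ∷ _) _ _ p∥r _ = —-unique e (—-sym e′) p≢r p∥r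
    bad {r} (q ∷ q′ ∷ l₁) es _ _ ih p∥r p#l₁ = close p∥r
      where
      l₁′ = q ∷ q′ ∷ l₁
      walk : Linked _⌢_ (p ∷ l₁′ ∷ʳ r)
      walk = Linked.map —⇒⌢ (proj₁ (Linked-++⁻ (p ∷ l₁′) es))
      parts = AllPairs-++⁻ l₁′ ih
      close : p ∥ r → ⊥
      close (inj₁ pre) = no-wordCycle p (s≤s (s≤s z≤n)) (p#l₁ ∷ proj₁ parts)
        (Linked-replaceLast (λ {z} → ⌢-prefixʳ {z} {r} {p} pre) (p ∷ l₁′) walk)
      close (inj₂ pre) = no-wordCycle r (s≤s (s≤s z≤n))
        (All.map (#-sym ∘ All.head) (proj₂ (proj₂ parts)) ∷ proj₁ parts)
        (Linked-replaceHead (λ {z} → ⌢-prefixˡ {p} {r} {z} pre) walk)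

  Headed : A → Pred Word a
  Headed b p = ∃ λ t → p ≡ b ∷ t

  headed? : ∀ b → Decidable (Headed b)
  headed? b []      = no λ ()
  headed? b (d ∷ p) with b ≟ d
  ... | yes refl = yes (p , refl)
  ... | no b≢d   = no λ { (_ , refl) → b≢d refl }

  ⌢-unheaded : ∀ {b p} → [ b ] ⌢ p → ¬ Headed b p
  ⌢-unheaded b⌢p (t , refl) = ⌢-sameHead {p = []} {t} b⌢p

  unheaded-# : ∀ {b p} → p ≢ [] → ¬ Headed b p → [ b ] # p
  unheaded-# {p = []}    p≢[] ¬h _                  = p≢[] refl
  unheaded-# {p = _ ∷ _} p≢[] ¬h (inj₁ (refl ∷ _)) = ¬h (_ , refl)
  unheaded-# {p = _ ∷ _} p≢[] ¬h (inj₂ (refl ∷ _)) = ¬h (_ , refl)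

  private
    -- Cutting the final word down to `[ b ]` and returning by `[ b ] ⌢ p` would give a forbidden
    -- cycle of words.
    no-detour : ∀ {b p q} l {r l′} → Linked _—_ (p ∷ q ∷ l ++ (b ∷ r) ∷ l′) → Unique (p ∷ q ∷ l ++ (b ∷ r) ∷ l′) →
      q ≢ [] → [ b ] ⌢ p → ¬ Headed b q → ¬ All (¬_ ∘ Headed b) l
    no-detour {b} {p} {q} l {r} {l′} es u q≢[] [b]⌢p ¬hq ¬hl =
      no-wordCycle [ b ] (s≤s (s≤s z≤n))
        (All.zipWith (λ (ne , ¬h) → unheaded-# ne ¬h)
          (Allₚ.++⁻ˡ (p ∷ q ∷ l) allNonempty , (⌢-unheaded [b]⌢p ∷ ¬hq ∷ ¬hl))
         ∷ proj₁ (AllPairs-++⁻ (p ∷ q ∷ l) (walk-# es′ u′ allNonempty)))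
        ([b]⌢p ∷ Linked-replaceLast (λ {z} → ⌢-prefixʳ {z} {b ∷ r} {[ b ]} (refl ∷ [])) (p ∷ q ∷ l)
                  (Linked.map —⇒⌢ es′))
      where
      es′ : Linked _—_ (p ∷ q ∷ l ∷ʳ (b ∷ r))
      es′ = proj₁ (Linked-++⁻ (p ∷ q ∷ l) es)
      u′ : Unique (p ∷ q ∷ l ∷ʳ (b ∷ r))
      u′ = proj₁ (AllPairs-++⁻ (p ∷ q ∷ l ∷ʳ (b ∷ r)) (subst Unique (cong (λ k → p ∷ q ∷ k) (sym (++-assoc l [ b ∷ r ] l′))) u))
      allNonempty : All (_≢ []) (p ∷ q ∷ l ∷ʳ (b ∷ r))
      allNonempty = go l es′ u′
        where
        go : ∀ l → Linked _—_ (p ∷ q ∷ l ∷ʳ (b ∷ r)) → Unique (p ∷ q ∷ l ∷ʳ (b ∷ r)) → All (_≢ []) (p ∷ q ∷ l ∷ʳ (b ∷ r))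
        go []      es u = walk-nonempty es u q≢[]
        go (_ ∷ _) es u = walk-nonempty es u q≢[]

    -- Every second vertex, starting with `q`, begins with `b`, since otherwise it is empty or
    -- `no-detour` applies. The letter can then be shifted across all edges, which turns the path
    -- into one from `θ b ∷ p` to `t`.
    follow-path : ∀ {b t} p l → Linked _—_ (p ∷ l) → Unique (p ∷ l) → EndsIn (b ∷ t) (p ∷ l) → [ b ] ⌢ p →
      (θ b ∷ p) ≈ t ⊎ p — []
    follow-path {t = t} p [] _ _ [-] b⌢p = contradiction b⌢p (⌢-sameHead {p = []} {t})
    follow-path {b} {t} p (q ∷ l) es u (_ ∷ end) b⌢p with headed? b q
    follow-path p (q ∷ []) (e ∷ _) u (_ ∷ [-]) b⌢p | yes _ = inj₁ (—-shift e ◅ ε)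
    follow-path {b} p (q ∷ r ∷ l) (e ∷ e′ ∷ es) (_ ∷ _ ∷ u) (_ ∷ _ ∷ end) b⌢p | yes (q′ , refl)
      with follow-path r l es u end (⌢-prefixˡ {b ∷ q′} {[ b ]} {r} (refl ∷ []) (—⇒⌢ e′))
    ... | inj₁ es′ = inj₁ (—-shift e ◅ —-unshift e′ ◅ es′)
    -- Here `r` would have both the empty word and `b ∷ q′` as neighbours.
    ... | inj₂ e″  with () ← —-empty e′ (—-sym e″)
    follow-path p ([] ∷ l)      (e ∷ _) u (_ ∷ end) b⌢p | no _ = inj₂ e
    follow-path {b} p ((d ∷ q) ∷ l) es u (_ ∷ end) b⌢p | no ¬h
      with first-Any (headed? b) (later ¬h (EndsIn⇒∈ end))
      where
      later : ∀ {q t l} → ¬ Headed b q → (b ∷ t) ∈ (q ∷ l) → Any (Headed b) l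
      later ¬h (here refl) = contradiction (_ , refl) ¬h
      later ¬h (there ∈l)  = Any.map (λ { refl → _ , refl }) ∈l
    ... | l₁ , _ , l₂ , refl , (_ , refl) , ¬hl₁ = contradiction ¬hl₁ (no-detour l₁ es u (λ ()) b⌢p ¬h)

  -- The letter θ b can be read from p as soon as it can be read from a state equivalent to p
  -- and the word obtained is in S, unless p is already a whole word of X.
  follow : ∀ {b p t} → p ≈ (b ∷ t) → [ b ] ⌢ p → (θ b ∷ p) ≈ t ⊎ p — []
  follow es with simplePath (≡-dec _≟_) es
  ... | l , es′ , u , end = follow-path _ l es′ u end

  -- The automaton is folded. `follow` is applied at the neighbour `r`, because `[ b ] ⌢ (b ∷ p)`
  -- never holds.
  ≈-cancel : ∀ {b p p′ r} → (b ∷ p) — r → (b ∷ p) ≈ (b ∷ p′) → p ≈ p′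
  ≈-cancel {b} {p} {r = r} e es with follow (—-sym e ◅ es) (⌢-prefixˡ {b ∷ p} {[ b ]} {r} (refl ∷ []) (—⇒⌢ e))
  ... | inj₁ es′ = —-unshift e ◅ es′
  ... | inj₂ e′  with () ← —-empty e (—-sym e′)

  -- Runs of the automaton, with a free change of representative before each letter. The edge in
  -- `read` certifies that `b ∷ q`, read forwards, is a prefix of a word of `X`.
  data Path : Word → Word → Word → Set (a ⊔ x) where
    stop : ∀ {p r} → p ≈ r → Path p [] r
    read : ∀ {p q q′ r b w} → p ≈ q → (b ∷ q) — q′ → Path (b ∷ q) w r → Path p (b ∷ w) r

  ≈-Path : ∀ {p q w r} → p ≈ q → Path q w r → Path p w r
  ≈-Path es (stop es′)     = stop (es ◅◅ es′)
  ≈-Path es (read es′ e π) = read (es ◅◅ es′) e π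

  Path-++ : ∀ {p q r u v} → Path p u q → Path q v r → Path p (u ++ v) r
  Path-++ (stop es)     π′ = ≈-Path es π′
  Path-++ (read es e π) π′ = read es e (Path-++ π π′)

  Path-X : ∀ p w → X (reverse p ++ w) → Path p w []
  Path-X p []      q = stop (edge q ◅ ε)
  Path-X p (b ∷ w) q = read ε (edge {r = map θ w} (subst (λ v → X (reverse (b ∷ p) ++ v)) (sym (map-θ-involutive w)) q′))
    (Path-X (b ∷ p) w q′)
    where
    q′ : X (reverse (b ∷ p) ++ w)
    q′ = subst X (sym (trans (cong (_++ w) (unfold-reverse b p)) (++-assoc (reverse p) [ b ] w))) q

  Path-X* : ∀ {w} → (X *) w → Path [] w []
  Path-X* (gen q)   = Path-X [] _ q
  Path-X* unit      = stop ε
  Path-X* (mul q r) = Path-++ (Path-X* q) (Path-X* r)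

  -- Reading `θ b` from `t` amounts to going back along a `b`: `t — (b ∷ t′)`. By foldedness
  -- `q ≈ t′`, and `t′` is adjacent to `θ b ∷ t`, where the rest of the path starts.
  Path-cancel : ∀ {p q q′ r b w} → p ≈ q → (b ∷ q) — q′ → Path (b ∷ q) (θ b ∷ w) r → Path p w r
  Path-cancel {b = b} es e (read {q = t} {q′ = t′} es′ e′ π) =
    ≈-Path (es ◅◅ ≈-cancel e (es′ ◅◅ (t—bt′ ◅ ε)) ◅◅ (—-sym e′ ◅ ε)) π
    where
    t—bt′ : t — (b ∷ t′)
    t—bt′ = subst (λ d → t — (d ∷ t′)) (θ-involutive b) (—-unshift e′)

  -- By `—-empty`, a vertex two steps away from the empty word is itself empty.
  ≈[] : ∀ {p} → p ≈ [] → p ≡ [] ⊎ p — []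
  ≈[] ε        = inj₁ refl
  ≈[] (e ◅ es) with ≈[] es
  ... | inj₁ refl = inj₂ e
  ... | inj₂ e′   = inj₁ (—-empty e (—-sym e′))

  —[]⇒X : ∀ {p} → p — [] → X (reverse p)
  —[]⇒X (edge q) = subst X (++-identityʳ _) q

  -- This passes from the representative `t` to `p` itself, by `follow` for the letter `θ b`: `p` is
  -- equivalent to `θ b ∷ t′`, and `[ θ b ] ⌢ p` restates the membership in `S`.
  readOn : ∀ {b t t′} p → S (reverse p ∷ʳ b) → (b ∷ t) — t′ → p ≈ t → (b ∷ p) ≈ (b ∷ t) ⊎ p — []
  readOn {b} {t} p pb∈S e es with follow (es ◅◅ (—-unshift e ◅ ε))
    (⌢-sym {p} {[ θ b ]} (subst (λ d → S (reverse p ∷ʳ d)) (sym (θ-involutive b)) pb∈S))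
  ... | inj₁ es′ = inj₁ (subst (λ d → (d ∷ p) ≈ (b ∷ t)) (θ-involutive b) (es′ ◅◅ (—-sym e ◅ ε)))
  ... | inj₂ e′  = inj₂ e′

  -- Here `p` is what has been read since the last completed word of `X`.
  Path⇒X* : ∀ p w → S (reverse p ++ w) → Path p w [] → (X *) (reverse p ++ w)
  Path⇒X* p [] _ (stop es) rewrite ++-identityʳ (reverse p) with ≈[] es
  ... | inj₁ refl = unit
  ... | inj₂ e    = gen (—[]⇒X e)
  Path⇒X* p (b ∷ w) pw∈S (read es e π)
    with readOn p (S-factor [] _ (subst S (sym (++-assoc (reverse p) [ b ] w)) pw∈S)) e es
  ... | inj₁ es′ = subst (X *) shape (Path⇒X* (b ∷ p) w (subst S (sym shape) pw∈S) (≈-Path es′ π))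
    where
    shape : reverse (b ∷ p) ++ w ≡ reverse p ++ b ∷ w
    shape = trans (cong (_++ w) (unfold-reverse b p)) (++-assoc (reverse p) [ b ] w)
  -- Now `reverse p` is in `X`. It is split off, and `b` is read from the empty prefix, which is the
  -- same state.
  ... | inj₂ e′ with readOn [] (S-factor (reverse p) [ b ] pw∈S) e (—-sym e′ ◅ es)
  ...   | inj₁ es′ = mul (gen (—[]⇒X e′)) (Path⇒X* [ b ] w
    (S-factor (reverse p) (b ∷ w) (subst S (cong (reverse p ++_) (sym (++-identityʳ _))) pw∈S)) (≈-Path es′ π))
  ...   | inj₂ (edge q) = contradiction refl (nonempty q)

-- The action on reduced words and the word problem

module ReducedWords {a} {A : Set a} (_≟_ : DecidableEquality A)
    (θ : A → A) (θ-involutive : ∀ b → θ (θ b) ≡ b) where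
  open Words A
  open Laminary θ
  open Inverses θ θ-involutive

  NoCancel : Pred Word a
  NoCancel = Linked λ b d → d ≢ θ b

  Reduced⇒NoCancel : ∀ w → Reduced w → NoCancel w
  Reduced⇒NoCancel []          r = []
  Reduced⇒NoCancel (b ∷ [])    r = [-]
  Reduced⇒NoCancel (b ∷ d ∷ w) r =
    (λ { refl → r b (infix-++ [] (b ∷ θ b ∷ [])) }) ∷ Reduced⇒NoCancel (d ∷ w) λ c → r c ∘ there

  infixr 5 _⊙_

  _⊙_ : A → Word → Word
  b ⊙ []      = [ b ]
  b ⊙ (d ∷ w) with d ≟ θ b
  ... | yes _ = w
  ... | no  _ = b ∷ d ∷ w

  ⊙-cancel : ∀ b w → b ⊙ θ b ∷ w ≡ w
  ⊙-cancel b w with θ b ≟ θ b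
  ... | yes _ = refl
  ... | no ne = contradiction refl ne

  ⊙-cons : ∀ {b w} → NoCancel (b ∷ w) → b ⊙ w ≡ b ∷ w
  ⊙-cons {b} {[]}    _        = refl
  ⊙-cons {b} {d ∷ w} (ne ∷ _) with d ≟ θ b
  ... | yes eq = contradiction eq ne
  ... | no _   = refl

  ⊙-NoCancel : ∀ b {w} → NoCancel w → NoCancel (b ⊙ w)
  ⊙-NoCancel b {[]}    _ = [-]
  ⊙-NoCancel b {d ∷ w} l with d ≟ θ b
  ... | yes _ = Linked.tail l
  ... | no ne = ne ∷ l

  -- If `w` begins with `b`, this letter is deleted and must be put back; it is not cancelled again
  -- because `w` is reduced.
  ⊙-inverse : ∀ b {w} → NoCancel w → b ⊙ θ b ⊙ w ≡ w
  ⊙-inverse b {[]}    _ = ⊙-cancel b []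
  ⊙-inverse b {d ∷ w} l with d ≟ θ (θ b)
  ... | no _   = ⊙-cancel b (d ∷ w)
  ... | yes eq rewrite trans eq (θ-involutive b) = ⊙-cons l

  act : Word → Word → Word
  act u w = foldr _⊙_ w u

  act-++ : ∀ u v w → act (u ++ v) w ≡ act u (act v w)
  act-++ u v w = foldr-++ _⊙_ w u v

  act-NoCancel : ∀ u {w} → NoCancel w → NoCancel (act u w)
  act-NoCancel []      l = l
  act-NoCancel (b ∷ u) l = ⊙-NoCancel b (act-NoCancel u l)

  act-reduced : ∀ {w} → NoCancel w → act w [] ≡ w
  act-reduced {[]}    _ = refl
  act-reduced {b ∷ w} l = trans (cong (b ⊙_) (act-reduced (Linked.tail l))) (⊙-cons l)

  act-inverseˡ : ∀ u {w} → NoCancel w → act (inverse u) (act u w) ≡ w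
  act-inverseˡ []      l = refl
  act-inverseˡ (b ∷ u) {w} l rewrite unfold-reverse (θ b) (map θ u) | act-++ (inverse u) [ θ b ] (b ⊙ act u w) =
    trans (cong (act (inverse u)) (trans (cong (λ d → θ b ⊙ d ⊙ act u w) (sym (θ-involutive b)))
                                         (⊙-inverse (θ b) (act-NoCancel u l))))
          (act-inverseˡ u l)

  act-inverseʳ : ∀ u {w} → NoCancel w → act u (act (inverse u) w) ≡ w
  act-inverseʳ u {w} l = trans (cong (λ v → act v (act (inverse u) w)) (sym (inverse-involutive u))) (act-inverseˡ (inverse u) l)

  flatten : Term → Word
  flatten (letter b) = [ b ]
  flatten one        = []
  flatten (t · u)    = flatten t ++ flatten u
  flatten (t ⁻)      = inverse (flatten t)

  flatten-⟦⟧ : ∀ w → flatten ⟦ w ⟧ ≡ w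
  flatten-⟦⟧ []      = refl
  flatten-⟦⟧ (b ∷ w) = cong (b ∷_) (flatten-⟦⟧ w)

  infix 4 _≗ʳ_

  _≗ʳ_ : Rel Word a
  u ≗ʳ v = ∀ {w} → NoCancel w → act u w ≡ act v w

  ++-cong : ∀ {u u′ v v′} → u ≗ʳ u′ → v ≗ʳ v′ → u ++ v ≗ʳ u′ ++ v′
  ++-cong {u} {u′} {v} {v′} p q {w} l = trans (act-++ u v w) (trans (cong (act u) (q l))
    (trans (p (act-NoCancel v′ l)) (sym (act-++ u′ v′ w))))

  inverse-cong : ∀ {u v} → u ≗ʳ v → inverse u ≗ʳ inverse v
  inverse-cong {u} {v} p l =
    trans (cong (act (inverse u)) (trans (sym (act-inverseʳ v l)) (sym (p (act-NoCancel (inverse v) l)))))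
          (act-inverseˡ u (act-NoCancel (inverse v) l))

  -- Van der Waerden's argument: the group acts on the reduced words. Acting on the empty word
  -- recovers the reduced representative.
  flatten-cong : ∀ {t u} → t ~ u → flatten t ≗ʳ flatten u
  flatten-cong (relation b)  l = ⊙-inverse b l
  flatten-cong (assoc t u v) {w} _ = cong (λ k → act k w) (++-assoc (flatten t) (flatten u) (flatten v))
  flatten-cong (identityˡ t) _ = refl
  flatten-cong (identityʳ t) {w} _ = cong (λ k → act k w) (++-identityʳ (flatten t))
  flatten-cong (inverseˡ t) {w} l = trans (act-++ (inverse (flatten t)) (flatten t) w) (act-inverseˡ (flatten t) l)
  flatten-cong (inverseʳ t) {w} l = trans (act-++ (flatten t) (inverse (flatten t)) w) (act-inverseʳ (flatten t) l)
  flatten-cong (·-cong {t} {t′} {u} {u′} p q) = ++-cong {flatten t} {flatten t′} {flatten u} {flatten u′} (flatten-cong p) (flatten-cong q)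
  flatten-cong (⁻-cong {t} {t′} p) = inverse-cong {flatten t} {flatten t′} (flatten-cong p)
  flatten-cong ~-refl        _ = refl
  flatten-cong (~-sym p)     l = sym (flatten-cong p l)
  flatten-cong (~-trans p q) l = trans (flatten-cong p l) (flatten-cong q l)

  ⟦⟧-++ : ∀ u v → ⟦ u ++ v ⟧ ~ ⟦ u ⟧ · ⟦ v ⟧
  ⟦⟧-++ []      v = ~-sym (identityˡ _)
  ⟦⟧-++ (b ∷ u) v = ~-trans (·-cong ~-refl (⟦⟧-++ u v)) (~-sym (assoc _ _ _))

  module _ {x} {X : Pred Word x} where

    X*⇒⟨X⟩ : ∀ {w} → (X *) w → ⟨ X ⟩ ⟦ w ⟧
    X*⇒⟨X⟩ (gen {w} q)       = gen (w , q , ~-refl)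
    X*⇒⟨X⟩ unit              = unit
    X*⇒⟨X⟩ (mul {u} {v} p q) = resp (~-sym (⟦⟧-++ u v)) (mul (X*⇒⟨X⟩ p) (X*⇒⟨X⟩ q))

    X*-inverse : ClosedUnderInverse X → ClosedUnderInverse (X *)
    X*-inverse X-inv (gen q)           = gen (X-inv q)
    X*-inverse X-inv unit              = unit
    X*-inverse X-inv (mul {u} {v} p q) =
      subst (X *) (sym (inverse-++ u v)) (mul (X*-inverse X-inv q) (X*-inverse X-inv p))

    -- Symmetry of `X` absorbs the inverses. The product `u` need not be reduced, so it is compared
    -- with `g` through the action only.
    ⟨X⟩⇒X* : ClosedUnderInverse X → ∀ {g} → ⟨ X ⟩ g → ∃ λ u → (X *) u × u ≗ʳ flatten g
    ⟨X⟩⇒X* X-inv (gen (w , q , g~w)) = w , gen q , λ {v} l →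
      trans (cong (λ k → act k v) (sym (flatten-⟦⟧ w))) (sym (flatten-cong g~w l))
    ⟨X⟩⇒X* X-inv unit = [] , unit , λ _ → refl
    ⟨X⟩⇒X* X-inv (mul {g} {k} p q) =
      let u , u∈ , eu = ⟨X⟩⇒X* X-inv p ; v , v∈ , ev = ⟨X⟩⇒X* X-inv q
      in u ++ v , mul u∈ v∈ , ++-cong {u} {flatten g} {v} {flatten k} eu ev
    ⟨X⟩⇒X* X-inv (inv {g} p) =
      let u , u∈ , eu = ⟨X⟩⇒X* X-inv p
      in inverse u , X*-inverse X-inv u∈ , inverse-cong {u} {flatten g} eu
    ⟨X⟩⇒X* X-inv (resp g~k p) =
      let u , u∈ , eu = ⟨X⟩⇒X* X-inv p in u , u∈ , λ l → trans (eu l) (flatten-cong g~k l)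

-- Saturation and prime words

module Saturation {a s x} {A : Set a} (_≟_ : DecidableEquality A)
    (θ : A → A) (θ-involutive : ∀ b → θ (θ b) ≡ b)
    {S : Pred (List A) s} (laminary : Laminary.LaminarySet θ S) (acyclicS : Words.Acyclic A S)
    {X : Pred (List A) x} (X-inverse : Laminary.ClosedUnderInverse θ X)
    (bifix : Words.BifixCode A X) (X⊆S : X ⊆ S) where
  open Words A
  open Laminary θ
  open BifixCode bifix
  open LaminarySet laminary using (reduced)
  open ReducedWords _≟_ θ θ-involutive
  open SymmetricBifixCode _≟_ θ θ-involutive laminary acyclicS X-inverse bifix X⊆S

  Path-⊙ : ∀ {p q q′ r} b w → p ≈ q → (b ∷ q) — q′ → Path (b ∷ q) w r → Path p (b ⊙ w) r
  Path-⊙ b []      es e π = read es e π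
  Path-⊙ b (d ∷ w) es e π with d ≟ θ b
  ... | yes refl = Path-cancel es e π
  ... | no _     = read es e π

  -- The word is reduced from right to left; each new letter prolongs the run or is removed by
  -- `Path-cancel`.
  Path-act : ∀ {p w r} → Path p w r → Path p (act w []) r
  Path-act (stop es)     = stop es
  Path-act (read es e π) = Path-⊙ _ _ es e (Path-act π)

  saturated : ∀ {w} → (⟨ X ⟩ ∩ʷ S) w → (X *) w
  saturated {w} (w∈X , w∈S) =
    let u , u∈X* , eq = ⟨X⟩⇒X* X-inverse w∈X
        act≡ : act u [] ≡ w
        act≡ = trans (eq []) (trans (cong (λ v → act v []) (flatten-⟦⟧ w)) (act-reduced (Reduced⇒NoCancel w (reduced w∈S))))
    in Path⇒X* [] w w∈S (subst (λ v → Path [] v []) act≡ (Path-act (Path-X* u∈X*)))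

  X*-head : ∀ {w} → (X *) w → w ≡ [] ⊎ ∃₂ λ u v → X u × w ≡ u ++ v
  X*-head (gen {w} q)  = inj₂ (w , [] , q , sym (++-identityʳ w))
  X*-head unit         = inj₁ refl
  X*-head (mul {w = w′} p q) with X*-head p
  ... | inj₁ refl = X*-head q
  ... | inj₂ (u , v , u∈X , refl) = inj₂ (u , v ++ w′ , u∈X , ++-assoc u v w′)

  prefix-++ : ∀ (u v : Word) → Prefix _≡_ u (u ++ v)
  prefix-++ u v = Prefixₚ.fromPointwise (Pointwise.≡⇒Pointwise-≡ refl) Prefix.++ᵖ v

  X⊆Prime : X ⊆ Prime S ⟨ X ⟩
  X⊆Prime {w} w∈X = record
    { nonempty = nonempty w∈X
    ; member   = X*⇒⟨X⟩ (gen w∈X) , X⊆S w∈X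
    ; minimal  = minimal
    }
    where
    minimal : ∀ {u} → ProperPrefix u w → u ≢ [] → ¬ (⟨ X ⟩ ∩ʷ S) u
    -- By saturation `u` begins with a word of `X`, which is then a proper prefix of `w`.
    minimal (u≤w , u≢w) u≢[] u∈ with X*-head (saturated u∈)
    ... | inj₁ eq                     = u≢[] eq
    ... | inj₂ (u′ , [] , u′∈X , refl) rewrite ++-identityʳ u′ = prefix u′∈X w∈X (u≤w , u≢w)
    ... | inj₂ (u′ , b ∷ v , u′∈X , refl) = prefix u′∈X w∈X
      (Prefixₚ.trans trans (prefix-++ u′ (b ∷ v)) u≤w , λ { refl → absurd u′ u≤w })
      where
      absurd : ∀ u → ¬ Prefix _≡_ (u ++ b ∷ v) u
      absurd (_ ∷ u) (_ ∷ p) = absurd u p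

  -- The first factor of `w` in `X` lies in the subgroup and in `S`, so by minimality it is all of
  -- `w`.
  Prime⊆X : Prime S ⟨ X ⟩ ⊆ X
  Prime⊆X {w} w-prime with X*-head (saturated (Prime.member w-prime))
  ... | inj₁ eq = contradiction eq (Prime.nonempty w-prime)
  ... | inj₂ (u , v , u∈X , eq) with ≡-dec _≟_ u w
  ...   | yes refl = u∈X
  ...   | no u≢w   = contradiction (X*⇒⟨X⟩ (gen u∈X) , X⊆S u∈X)
    (Prime.minimal w-prime (subst (Prefix _≡_ u) (sym eq) (prefix-++ u v) , u≢w) (nonempty u∈X))

theorem7p8 : {a s x : Level} (A : Set a) (n : ℕ) → A ↔ Fin n → (θ : A → A) → Involutive _≡_ θ →
    let open Words A
        open Laminary θ in
    (S : Pred Word s) → LaminarySet S → Acyclic S →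
    (X : Pred Word x) → Finite X → ClosedUnderInverse X → BifixCode X → X ⊆ S →
    (X ≐ Prime S ⟨ X ⟩) × ((⟨ X ⟩ ∩ʷ S) ≐ ((X *) ∩ S))
theorem7p8 A n A↔Fin θ θ-involutive S laminary acyclicS X _ X-inverse bifix X⊆S =
  (X⊆Prime , Prime⊆X) ,
  ((λ w∈ → saturated w∈ , proj₂ w∈) , λ (w∈X* , w∈S) → X*⇒⟨X⟩ w∈X* , w∈S)
  where
  open ReducedWords (Finₚ.inj⇒≟ (↔⇒↣ A↔Fin)) θ θ-involutive using (X*⇒⟨X⟩)
  open Saturation (Finₚ.inj⇒≟ (↔⇒↣ A↔Fin)) θ θ-involutive laminary acyclicS X-inverse bifix X⊆S
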